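{- For all $n\ge0$, $$F_n(x,y,q)F_{n+1}(x,y,q)=\sum_{j=0}^nxy^jq^{\lfloor j^2/2\rfloor}F_{n-j}(xq^j,yq^j,q)F_{n-j}(xq^{j+1},yq^{j+1},q).$$
   Context: $\Pi_n(13/2,123)$ is the set of layered matchings of $[n]$: set partitions whose blocks are consecutive intervals $[1,i_1]/\dots/[i_{k-1}+1,n]$, each of size $1$ or $2$. $\Pi_0(13/2,123)$ consists of the empty partition. For $\pi=B_1/\dots/B_k$ with $\min B_1<\dots<\min B_k$, $rb(\pi)$ is the number of pairs $(b,B_j)$ with $b\in B_i$, $j>i$, $\max B_j>b$. Let $s(\pi)$ and $d(\pi)$ be the numbers of blocks of size $1$ and $2$. Define $F_n(x,y,q)=\sum_{\pi\in\Pi_n(13/2,123)}x^{s(\pi)}y^{d(\pi)}q^{rb(\pi)}$, so $F_0=1$ and $F_1=x$. $F_n(xq^a,yq^a,q)$ denotes the substitution $x\mapsto xq^a$, $y\mapsto yq^a$. -}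

module Defs where

open import Algebra.Bundles using (CommutativeRing)
import Algebra.Properties.Semiring.Exp as Exp
import Algebra.Properties.Semiring.Sum as Sum
open import Data.Empty using (⊥)
open import Data.List.Base
  using (List; []; _∷_; _++_; map; concat; foldr; filter; length; iterate; cartesianProduct)
import Data.List.Extrema.Nat as Extrema
open import Data.List.Membership.Propositional using (_∈_)
open import Data.List.Membership.Propositional.Properties
  using (∈-++⁺ˡ; ∈-++⁺ʳ; ∈-++⁻; ∈-map⁺; ∈-map⁻)
open import Data.List.NonEmpty.Base as List⁺ using (List⁺; _∷_)
open import Data.List.Properties using (∷-injectiveʳ)
open import Data.List.Relation.Binary.Permutation.Propositional
  using (_↭_; ↭-refl; ↭-sym)
open import Data.List.Relation.Binary.Permutation.Propositional.Properties
  using (∈-resp-↭; drop-∷; ↭-length)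
open import Data.List.Relation.Unary.All as All using (All; []; _∷_)
open import Data.List.Relation.Unary.AllPairs using (AllPairs; []; _∷_)
open import Data.List.Relation.Unary.Any using (here; there)
open import Data.List.Relation.Unary.Unique.Propositional using (Unique)
import Data.List.Relation.Unary.Unique.Propositional.Properties as Unique
open import Data.Nat.Base using (ℕ; zero; suc; _+_; _<_; _≤_)
open import Data.Nat.Properties
  using (_≟_; _<?_; ≤-refl; ≤-trans; ≤-antisym; <⇒≤; n<1+n; n≤1+n)
open import Data.Product.Base using (∃-syntax; _×_; _,_)
open import Data.Sum.Base using (_⊎_; inj₁; inj₂)
open import Function.Base using (case_of_)
open import Function.Bundles using (_⇔_; mk⇔)
open import Relation.Binary.PropositionalEquality
  using (_≡_; refl; sym; trans; subst)

Block : Set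
Block = List⁺ ℕ

min max : Block → ℕ
min (b ∷ bs) = Extrema.min b bs
max (b ∷ bs) = Extrema.max b bs

-- A set partition B₁/…/Bₖ is represented by the list of its blocks in order of
-- increasing minimum, and each block by the increasing list of its elements,
-- so that each set partition has exactly one representation.
Partition : Set
Partition = List Block

elements : Partition → List ℕ
elements π = concat (map List⁺.toList π)

record IsSetPartition (n : ℕ) (π : Partition) : Set where
  field
    increasing : All (λ B → AllPairs _<_ (List⁺.toList B)) π
    ordered    : AllPairs (λ B C → min B < min C) π
    covers     : elements π ↭ iterate suc 1 n

IsInterval : Block → Set
IsInterval B = ∃[ m ] List⁺.toList B ≡ iterate suc m (List⁺.length B)

record IsLayeredMatching (n : ℕ) (π : Partition) : Set where
  field
    isSetPartition : IsSetPartition n π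
    layered        : All IsInterval π
    matching       : All (λ B → List⁺.length B ≡ 1 ⊎ List⁺.length B ≡ 2) π

-- The layered matchings of {a, a + 1, …, a + n - 1}.
layeredMatchingsFrom : ℕ → ℕ → List Partition
layeredMatchingsFrom a 0             = [] ∷ []
layeredMatchingsFrom a 1             = ((a ∷ []) ∷ []) ∷ []
layeredMatchingsFrom a (suc (suc n)) =
  map ((a ∷ []) ∷_) (layeredMatchingsFrom (suc a) (suc n)) ++
  map ((a ∷ suc a ∷ []) ∷_) (layeredMatchingsFrom (suc (suc a)) n)

-- That this lists every layered matching of [n] exactly once is shown by
-- ∈-layeredMatchings and layeredMatchings-unique below.
layeredMatchings : ℕ → List Partition
layeredMatchings n = layeredMatchingsFrom 1 n

-- As the blocks are disjoint, b determines Bᵢ, so the pairs (b , Bⱼ) may be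
-- counted separately for each Bᵢ.
rb : Partition → ℕ
rb []      = 0
rb (B ∷ π) =
  length (filter (λ (b , C) → b <? max C) (cartesianProduct (List⁺.toList B) π)) + rb π

blocksOfSize : ℕ → Partition → ℕ
blocksOfSize k π = length (filter (λ B → List⁺.length B ≟ k) π)

s d : Partition → ℕ
s = blocksOfSize 1
d = blocksOfSize 2

-- Polynomials in x, y, q are represented by their values at arbitrary elements
-- of an arbitrary commutative ring; taking R = ℤ[x,y,q] and the indeterminates
-- themselves recovers the formal polynomials.
module GeneratingFunction {c ℓ} (R : CommutativeRing c ℓ) where
  open CommutativeRing R using (Carrier; 0#; semiring) renaming (_+_ to _⊕_; _*_ to _⊛_)
  open Exp semiring public using (_^_)
  open Sum semiring public using (sum⁺-syntax)

  F : ℕ → Carrier → Carrier → Carrier → Carrier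
  F n x y q =
    foldr _⊕_ 0# (map (λ π → x ^ s π ⊛ y ^ d π ⊛ q ^ rb π) (layeredMatchings n))

private
  Size12 : Block → Set
  Size12 B = List⁺.length B ≡ 1 ⊎ List⁺.length B ≡ 2

  record Good (a n : ℕ) (π : Partition) : Set where
    field
      increasing : All (λ B → AllPairs _<_ (List⁺.toList B)) π
      ordered    : AllPairs (λ B C → min B < min C) π
      covers     : elements π ↭ iterate suc a n
      layered    : All IsInterval π
      matching   : All Size12 π

  min≤ : ∀ B {b} → b ∈ List⁺.toList B → min B ≤ b
  min≤ (b ∷ bs) (here refl) = Extrema.min≤⊤ b bs
  min≤ (b ∷ bs) (there b∈)  = All.lookup (Extrema.min≤xs b bs) b∈

  min∈ : ∀ B → min B ∈ List⁺.toList B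
  min∈ (b ∷ bs) with Extrema.argmin-sel (λ z → z) b bs
  ... | inj₁ e = here e
  ... | inj₂ i = there i

  ≤iterate : ∀ a n {b} → b ∈ iterate suc a n → a ≤ b
  ≤iterate a (suc n) (here refl) = ≤-refl
  ≤iterate a (suc n) (there b∈)  = <⇒≤ (≤iterate (suc a) n b∈)

  lowerBound : ∀ a π → All (λ b → a ≤ b) (elements π) → All (λ B → a ≤ min B) π
  lowerBound a π h = All.tabulate λ {B} B∈ → All.lookup h (inBlock π B∈ (min∈ B))
    where
    inBlock : ∀ π {B b} → B ∈ π → b ∈ List⁺.toList B → b ∈ elements π
    inBlock (B ∷ π) (here refl) b∈ = ∈-++⁺ˡ b∈
    inBlock (B ∷ π) (there B∈)  b∈ = ∈-++⁺ʳ (List⁺.toList B) (inBlock π B∈ b∈)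

  min-pair : ∀ a → min (a ∷ suc a ∷ []) ≡ a
  min-pair a with min∈ (a ∷ suc a ∷ [])
  ... | here e         = e
  ... | there (here e) = ≤-antisym (min≤ (a ∷ suc a ∷ []) (here refl))
                           (subst (a ≤_) (sym e) (n≤1+n a))

  elements≥ : ∀ a n π → elements π ↭ iterate suc a n → All (λ b → a ≤ b) (elements π)
  elements≥ a n π p = All.tabulate λ b∈ → ≤iterate a n (∈-resp-↭ p b∈)

  good-single : ∀ a n {π} → Good (suc a) n π → Good a (suc n) ((a ∷ []) ∷ π)
  good-single a n {π} g = record
    { increasing = ([] ∷ []) ∷ increasing
    ; ordered    = lowerBound (suc a) π (elements≥ (suc a) n π covers) ∷ ordered
    ; covers     = _↭_.prep a covers
    ; layered    = (a , refl) ∷ layered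
    ; matching   = inj₁ refl ∷ matching
    } where open Good g

  good-pair : ∀ a n {π} → Good (suc (suc a)) n π →
              Good a (suc (suc n)) ((a ∷ suc a ∷ []) ∷ π)
  good-pair a n {π} g = record
    { increasing = ((n<1+n a ∷ []) ∷ [] ∷ []) ∷ increasing
    ; ordered    = All.map (λ le → subst (_< _) (sym (min-pair a)) (<⇒≤ le))
                     (lowerBound (suc (suc a)) π (elements≥ (suc (suc a)) n π covers)) ∷ ordered
    ; covers     = _↭_.prep a (_↭_.prep (suc a) covers)
    ; layered    = (a , refl) ∷ layered
    ; matching   = inj₂ refl ∷ matching
    } where open Good g

  good-empty : ∀ a → Good a 0 []
  good-empty a = record
    { increasing = [] ; ordered = [] ; covers = ↭-refl ; layered = [] ; matching = [] }

  sound : ∀ a n {π} → π ∈ layeredMatchingsFrom a n → Good a n π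
  sound a 0 (here refl) = good-empty a
  sound a 1 (here refl) = good-single a 0 (good-empty (suc a))
  sound a (suc (suc n)) π∈
    with ∈-++⁻ (map ((a ∷ []) ∷_) (layeredMatchingsFrom (suc a) (suc n))) π∈
  ... | inj₁ i with ∈-map⁻ _ i
  ...   | ρ , ρ∈ , refl = good-single a (suc n) (sound (suc a) (suc n) ρ∈)
  sound a (suc (suc n)) π∈ | inj₂ i with ∈-map⁻ _ i
  ...   | ρ , ρ∈ , refl = good-pair a n (sound (suc (suc a)) n ρ∈)

  first≤ : ∀ B π → AllPairs (λ B C → min B < min C) (B ∷ π) →
           ∀ {b} → b ∈ elements (B ∷ π) → min B ≤ b
  first≤ B π (lt ∷ o) {b} b∈ with ∈-++⁻ (List⁺.toList B) b∈
  ... | inj₁ i = min≤ B i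
  ... | inj₂ i = go π lt i
    where
    go : ∀ ρ → All (λ C → min B < min C) ρ → b ∈ elements ρ → min B ≤ b
    go (C ∷ ρ) (l ∷ ls) j with ∈-++⁻ (List⁺.toList C) j
    ... | inj₁ k = ≤-trans (<⇒≤ l) (min≤ C k)
    ... | inj₂ k = go ρ ls k

  first≡ : ∀ a n B π → Good a (suc n) (B ∷ π) → min B ≡ a
  first≡ a n B π g = ≤-antisym
    (first≤ B π ordered (∈-resp-↭ (↭-sym covers) (here refl)))
    (≤iterate a (suc n) (∈-resp-↭ covers (∈-++⁺ˡ (min∈ B))))
    where open Good g

  complete : ∀ a n π → Good a n π → π ∈ layeredMatchingsFrom a n
  complete a 0 [] g = here refl
  complete a 0 ((b ∷ bs) ∷ π) g = case ↭-length (Good.covers g) of λ ()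
  complete a (suc n) [] g = case ↭-length (Good.covers g) of λ ()
  complete a (suc n) (B@(b ∷ []) ∷ π) g with first≡ a n B π g
  ... | refl = extend n (complete (suc a) n π record
    { increasing = All.tail increasing
    ; ordered    = case ordered of λ { (_ ∷ o) → o }
    ; covers     = drop-∷ covers
    ; layered    = All.tail layered
    ; matching   = All.tail matching
    })
    where
    open Good g
    extend : ∀ n → π ∈ layeredMatchingsFrom (suc a) n →
             ((a ∷ []) ∷ π) ∈ layeredMatchingsFrom a (suc n)
    extend 0       (here refl) = here refl
    extend (suc n) π∈          = ∈-++⁺ˡ (∈-map⁺ _ π∈)
  complete a 1 (B@(b ∷ c ∷ []) ∷ π) g = case ↭-length (Good.covers g) of λ ()
  complete a (suc (suc n)) (B@(b ∷ c ∷ []) ∷ π) g with Good.layered g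
  ... | (_ , refl) ∷ ls with trans (sym (min-pair b)) (first≡ a (suc n) B π g)
  ...   | refl = ∈-++⁺ʳ _ (∈-map⁺ _ (complete (suc (suc a)) n π record
    { increasing = All.tail increasing
    ; ordered    = case ordered of λ { (_ ∷ o) → o }
    ; covers     = drop-∷ (drop-∷ covers)
    ; layered    = ls
    ; matching   = All.tail matching
    }))
    where open Good g
  complete a (suc n) ((b ∷ c ∷ e ∷ bs) ∷ π) g with Good.matching g
  ... | inj₁ () ∷ _
  ... | inj₂ () ∷ _

  unique : ∀ a n → Unique (layeredMatchingsFrom a n)
  unique a 0 = [] ∷ []
  unique a 1 = [] ∷ []
  unique a (suc (suc n)) = Unique.++⁺
    (Unique.map⁺ ∷-injectiveʳ (unique (suc a) (suc n)))
    (Unique.map⁺ ∷-injectiveʳ (unique (suc (suc a)) n))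
    λ (i , j) → disjoint (∈-map⁻ _ i) (∈-map⁻ _ j)
    where
    disjoint : ∀ {π} {ps qs : List Partition} →
               ∃[ ρ ] ρ ∈ ps × π ≡ (a ∷ []) ∷ ρ →
               ∃[ ρ ] ρ ∈ qs × π ≡ (a ∷ suc a ∷ []) ∷ ρ → ⊥
    disjoint (_ , _ , refl) (_ , _ , ())

∈-layeredMatchings : ∀ n π → π ∈ layeredMatchings n ⇔ IsLayeredMatching n π
∈-layeredMatchings n π = mk⇔ to from
  where
  to : π ∈ layeredMatchings n → IsLayeredMatching n π
  to π∈ = record
    { isSetPartition = record { increasing = increasing ; ordered = ordered ; covers = covers }
    ; layered  = layered
    ; matching = matching
    } where open Good (sound 1 n π∈)

  from : IsLayeredMatching n π → π ∈ layeredMatchings n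
  from m = complete 1 n π record
    { increasing = increasing ; ordered = ordered ; covers = covers
    ; layered = layered ; matching = matching }
    where
    open IsLayeredMatching m
    open IsSetPartition isSetPartition

layeredMatchings-unique : ∀ n → Unique (layeredMatchings n)
layeredMatchings-unique n = unique 1 n

{-# OPTIONS --safe #-}

-- Removing the first block of a layered matching gives
--   Fₙ(x,y) = x Fₙ₋₁(xq,yq) + y Fₙ₋₂(xq²,yq²),
-- because every element of the first block is smaller than the maximum of every
-- later block.  Expanding Fₙ₊₁ by this recurrence gives the summand j = 0 plus
-- y Fₙ(x,y) Fₙ₋₁(xq²,yq²); expanding Fₙ there gives the summand j = 1 plus
-- y² (Fₙ₋₂ Fₙ₋₁)(xq²,yq²).  By induction the last term is the sum of the
-- summands j ≥ 2, since ⌊(j+2)²/2⌋ = ⌊j²/2⌋ + 2j + 2.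
module Submission where

open import Defs
open import Algebra.Bundles using (CommutativeRing)
import Algebra.Properties.CommutativeSemiring.Exp as Exp
import Algebra.Properties.Semiring.Sum as Sum
import Algebra.Solver.Ring.NaturalCoefficients.Default as RingSolver
open import Data.Fin.Base using (toℕ)
open import Data.List.Base using (List; []; _∷_; _++_; map; foldr; length; cartesianProduct)
import Data.List.Extrema.Nat as Extrema
open import Data.List.NonEmpty.Base as List⁺ using (_∷_)
open import Data.List.Properties using (filter-all; length-++; length-map)
open import Data.List.Relation.Unary.All as All using (All; []; _∷_)
import Data.List.Relation.Unary.All.Properties as All
open import Data.Nat.Base using (ℕ; zero; suc; _∸_; _≤_; _<_; ⌊_/2⌋)
import Data.Nat.Base as ℕ
open import Data.Nat.Properties using (_<?_; ≤-refl; ≤-trans; n≤1+n; +-suc)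
open import Data.Nat.Solver using (module +-*-Solver)
open import Data.Product.Base using (_,_)
open import Relation.Binary.PropositionalEquality as ≡ using (_≡_; refl; cong; cong₂)
import Relation.Binary.PropositionalEquality.Properties as ≡
import Relation.Binary.Reasoning.Setoid as SetoidReasoning

-- Counting pairs and halving squares.

length-cartesianProduct : ∀ {a b} {A : Set a} {B : Set b} (xs : List A) (ys : List B) →
  length (cartesianProduct xs ys) ≡ length xs ℕ.* length ys
length-cartesianProduct []       ys = refl
length-cartesianProduct (x ∷ xs) ys =
  ≡.trans (length-++ (map (x ,_) ys))
          (cong₂ ℕ._+_ (length-map (x ,_) ys) (length-cartesianProduct xs ys))

⌊m+m+n/2⌋≡m+⌊n/2⌋ : ∀ m n → ⌊ m ℕ.+ m ℕ.+ n /2⌋ ≡ m ℕ.+ ⌊ n /2⌋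
⌊m+m+n/2⌋≡m+⌊n/2⌋ zero    n = refl
⌊m+m+n/2⌋≡m+⌊n/2⌋ (suc m) n rewrite +-suc m m = cong suc (⌊m+m+n/2⌋≡m+⌊n/2⌋ m n)

-- Since (j+2)² is j² plus twice 2j+2, halving splits off 2j+2 exactly, whatever the parity of j.
⌊[2+j]²/2⌋ : ∀ j → ⌊ suc (suc j) ℕ.^ 2 /2⌋ ≡ suc (suc (j ℕ.+ j)) ℕ.+ ⌊ j ℕ.^ 2 /2⌋
⌊[2+j]²/2⌋ j = ≡.trans
  (cong ⌊_/2⌋ (solve 1 (λ j → (con 2 :+ j) :^ 2 :=
                  (con 2 :+ (j :+ j)) :+ (con 2 :+ (j :+ j)) :+ j :^ 2) refl j))
  (⌊m+m+n/2⌋≡m+⌊n/2⌋ (suc (suc (j ℕ.+ j))) (j ℕ.^ 2))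
  where open +-*-Solver

-- Block maxima and block counts of layered matchings.

-- What the weight computation uses about the matching left after its first block is removed:
-- `max≥a` makes each later block count against each removed element, and `length≡s+d` lets one
-- factor per block be absorbed into x and y.
record LayeredFrom (a : ℕ) (π : Partition) : Set where
  field
    max≥a      : All (λ B → a ≤ max B) π
    length≡s+d : length π ≡ s π ℕ.+ d π

layeredFrom-single : ∀ a {π} → LayeredFrom (suc a) π → LayeredFrom a ((a ∷ []) ∷ π)
layeredFrom-single a l = record
  { max≥a      = ≤-refl ∷ All.map (≤-trans (n≤1+n a)) max≥a
  ; length≡s+d = cong suc length≡s+d
  } where open LayeredFrom l

layeredFrom-pair : ∀ a {π} → LayeredFrom (suc (suc a)) π →
                   LayeredFrom a ((a ∷ suc a ∷ []) ∷ π)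
layeredFrom-pair a {π} l = record
  { max≥a      = Extrema.⊥≤max a (suc a ∷ []) ∷
                 All.map (λ le → ≤-trans (n≤1+n a) (≤-trans (n≤1+n (suc a)) le)) max≥a
  ; length≡s+d = ≡.trans (cong suc length≡s+d) (≡.sym (+-suc (s π) (d π)))
  } where open LayeredFrom l

layeredMatchingsFrom-layered : ∀ a n → All (LayeredFrom a) (layeredMatchingsFrom a n)
layeredMatchingsFrom-layered a 0 = record { max≥a = [] ; length≡s+d = refl } ∷ []
layeredMatchingsFrom-layered a 1 =
  layeredFrom-single a (record { max≥a = [] ; length≡s+d = refl }) ∷ []
layeredMatchingsFrom-layered a (suc (suc n)) = All.++⁺
  (All.map⁺ (All.map (layeredFrom-single a) (layeredMatchingsFrom-layered (suc a) (suc n))))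
  (All.map⁺ (All.map (layeredFrom-pair a) (layeredMatchingsFrom-layered (suc (suc a)) n)))

-- Under the hypothesis the filter in `rb` keeps every pair, so the count is the size of the whole
-- product of `B` with `π`.
rb-∷ : ∀ B π → All (λ b → All (λ C → b < max C) π) (List⁺.toList B) →
       rb (B ∷ π) ≡ List⁺.length B ℕ.* length π ℕ.+ rb π
rb-∷ B π B<π = cong (ℕ._+ rb π) (≡.trans
  (cong length (filter-all (λ (b , C) → b <? max C)
    (All.cartesianProduct⁺ (≡.setoid ℕ) (≡.setoid Block) (List⁺.toList B) π
      λ b∈ C∈ → All.lookup (All.lookup B<π b∈) C∈)))
  (length-cartesianProduct (List⁺.toList B) π))

module _ {c ℓ} (R : CommutativeRing c ℓ) where
  open CommutativeRing R renaming (refl to ≈-refl)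
  open GeneratingFunction R
  open Exp commutativeSemiring using (^-congˡ; ^-congʳ; ^-homo-*; ^-assocʳ; ^-distrib-*)
  open Sum semiring using (sum-cong-≋; *-distribˡ-sum)
  open RingSolver commutativeSemiring using (solve; con; _:+_; _:*_; _:=_)
  open SetoidReasoning setoid

  -- Effect of removing the first block on the weight.

  weight : Carrier → Carrier → Carrier → Partition → Carrier
  weight x y q π = x ^ s π * y ^ d π * q ^ rb π

  total : (Partition → Carrier) → List Partition → Carrier
  total w πs = foldr _+_ 0# (map w πs)

  total-++ : ∀ w πs ρs → total w (πs ++ ρs) ≈ total w πs + total w ρs
  total-++ w []       ρs = sym (+-identityˡ _)
  total-++ w (π ∷ πs) ρs = trans (+-congˡ (total-++ w πs ρs)) (sym (+-assoc _ _ _))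

  total-map : ∀ {w w′ g} k {πs} → All (λ π → w (g π) ≈ k * w′ π) πs →
              total w (map g πs) ≈ k * total w′ πs
  total-map k []       = sym (zeroʳ k)
  total-map k (e ∷ es) = trans (+-cong e (total-map k es)) (sym (distribˡ k _ _))

  -- The exponent k times the number of blocks means one factor `q ^ k` per block. Each block
  -- carries exactly one x or y, so these factors turn into the substitution of `x * q ^ k` and
  -- `y * q ^ k`.
  weight-shift : ∀ k x y q π → length π ≡ s π ℕ.+ d π →
    x ^ s π * y ^ d π * q ^ (k ℕ.* length π ℕ.+ rb π) ≈ weight (x * q ^ k) (y * q ^ k) q π
  weight-shift k x y q π len = begin
    x ^ s π * y ^ d π * q ^ (k ℕ.* length π ℕ.+ rb π)
      ≈⟨ *-congˡ (^-homo-* q (k ℕ.* length π) (rb π)) ⟩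
    x ^ s π * y ^ d π * (q ^ (k ℕ.* length π) * q ^ rb π)
      ≈⟨ *-congˡ (*-congʳ (sym (^-assocʳ q k (length π)))) ⟩
    x ^ s π * y ^ d π * ((q ^ k) ^ length π * q ^ rb π)
      ≈⟨ *-congˡ (*-congʳ (trans (^-congʳ (q ^ k) len) (^-homo-* (q ^ k) (s π) (d π)))) ⟩
    x ^ s π * y ^ d π * ((q ^ k) ^ s π * (q ^ k) ^ d π * q ^ rb π)
      ≈⟨ solve 5 (λ a b c d e → a :* b :* (c :* d :* e) := a :* c :* (b :* d) :* e) ≈-refl
           (x ^ s π) (y ^ d π) ((q ^ k) ^ s π) ((q ^ k) ^ d π) (q ^ rb π) ⟩
    x ^ s π * (q ^ k) ^ s π * (y ^ d π * (q ^ k) ^ d π) * q ^ rb π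
      ≈⟨ *-congʳ (*-cong (sym (^-distrib-* x (q ^ k) (s π))) (sym (^-distrib-* y (q ^ k) (d π)))) ⟩
    weight (x * q ^ k) (y * q ^ k) q π ∎

  weight-single : ∀ a x y q {π} → LayeredFrom (suc a) π →
    weight x y q ((a ∷ []) ∷ π) ≈ x * weight (x * q ^ 1) (y * q ^ 1) q π
  weight-single a x y q {π} l = begin
    x * x ^ s π * y ^ d π * q ^ rb ((a ∷ []) ∷ π)
      -- Here `suc a ≤ max C` is by definition `a < max C`, so `max≥a` fits as it is.
      ≈⟨ *-congˡ (^-congʳ q (rb-∷ (a ∷ []) π (max≥a ∷ []))) ⟩
    x * x ^ s π * y ^ d π * q ^ (1 ℕ.* length π ℕ.+ rb π)
      ≈⟨ solve 4 (λ x a b c → x :* a :* b :* c := x :* (a :* b :* c)) ≈-refl _ _ _ _ ⟩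
    x * (x ^ s π * y ^ d π * q ^ (1 ℕ.* length π ℕ.+ rb π))
      ≈⟨ *-congˡ (weight-shift 1 x y q π length≡s+d) ⟩
    x * weight (x * q ^ 1) (y * q ^ 1) q π ∎
    where open LayeredFrom l

  weight-pair : ∀ a x y q {π} → LayeredFrom (suc (suc a)) π →
    weight x y q ((a ∷ suc a ∷ []) ∷ π) ≈ y * weight (x * q ^ 2) (y * q ^ 2) q π
  weight-pair a x y q {π} l = begin
    x ^ s π * (y * y ^ d π) * q ^ rb ((a ∷ suc a ∷ []) ∷ π)
      -- Both elements lie below every later maximum, hence the factor 2: `max≥a` is the bound for
      -- `suc a`, and weakening it gives the one for `a`.
      ≈⟨ *-congˡ (^-congʳ q (rb-∷ (a ∷ suc a ∷ []) π
           (All.map (≤-trans (n≤1+n (suc a))) max≥a ∷ max≥a ∷ []))) ⟩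
    x ^ s π * (y * y ^ d π) * q ^ (2 ℕ.* length π ℕ.+ rb π)
      ≈⟨ solve 4 (λ y a b c → a :* (y :* b) :* c := y :* (a :* b :* c)) ≈-refl _ _ _ _ ⟩
    y * (x ^ s π * y ^ d π * q ^ (2 ℕ.* length π ℕ.+ rb π))
      ≈⟨ *-congˡ (weight-shift 2 x y q π length≡s+d) ⟩
    y * weight (x * q ^ 2) (y * q ^ 2) q π ∎
    where open LayeredFrom l

  -- The recurrence for the generating function.

  -- The recurrence taken as a definition, so that later proofs unfold it by computation. The powers
  -- `q ^ 1` and `q ^ 2` are left unsimplified so that they agree by computation with the
  -- `q ^ suc j` of the summands.
  f : ℕ → Carrier → Carrier → Carrier → Carrier
  f 0             x y q = 1#
  f 1             x y q = x
  f (suc (suc n)) x y q =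
    x * f (suc n) (x * q ^ 1) (y * q ^ 1) q + y * f n (x * q ^ 2) (y * q ^ 2) q

  f-cong : ∀ n {x x′ y y′} q → x ≈ x′ → y ≈ y′ → f n x y q ≈ f n x′ y′ q
  f-cong 0             q x≈ y≈ = ≈-refl
  f-cong 1             q x≈ y≈ = x≈
  f-cong (suc (suc n)) q x≈ y≈ = +-cong
    (*-cong x≈ (f-cong (suc n) q (*-congʳ x≈) (*-congʳ y≈)))
    (*-cong y≈ (f-cong n q (*-congʳ x≈) (*-congʳ y≈)))

  -- The starting point `a` is arbitrary because removing the first block leaves a matching of a
  -- later interval; the value does not depend on it. `F` is the case `a` = 1 by definition.
  total-layeredMatchingsFrom : ∀ a n x y q →
    total (weight x y q) (layeredMatchingsFrom a n) ≈ f n x y q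
  total-layeredMatchingsFrom a 0 x y q =
    solve 0 (con 1 :* con 1 :* con 1 :+ con 0 := con 1) ≈-refl
  total-layeredMatchingsFrom a 1 x y q =
    solve 1 (λ x → x :* con 1 :* con 1 :* con 1 :+ con 0 := x) ≈-refl x
  total-layeredMatchingsFrom a (suc (suc n)) x y q = trans
    (total-++ (weight x y q) (map ((a ∷ []) ∷_) (layeredMatchingsFrom (suc a) (suc n))) _)
    (+-cong
      (trans (total-map x (All.map (weight-single a x y q)
                             (layeredMatchingsFrom-layered (suc a) (suc n))))
             (*-congˡ (total-layeredMatchingsFrom (suc a) (suc n) _ _ q)))
      (trans (total-map y (All.map (weight-pair a x y q)
                             (layeredMatchingsFrom-layered (suc (suc a)) n)))
             (*-congˡ (total-layeredMatchingsFrom (suc (suc a)) n _ _ q))))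

  F≈f : ∀ n x y q → F n x y q ≈ f n x y q
  F≈f = total-layeredMatchingsFrom 1

  -- The product identity.

  summand : ℕ → Carrier → Carrier → Carrier → ℕ → Carrier
  summand n x y q j =
    x * y ^ j * q ^ ⌊ j ℕ.^ 2 /2⌋
      * f (n ∸ j) (x * q ^ j) (y * q ^ j) q
      * f (n ∸ j) (x * q ^ suc j) (y * q ^ suc j) q

  summand≈ : ∀ n x y q j → summand n x y q j ≈
    x * y ^ j * q ^ ⌊ j ℕ.^ 2 /2⌋
      * F (n ∸ j) (x * q ^ j) (y * q ^ j) q
      * F (n ∸ j) (x * q ^ suc j) (y * q ^ suc j) q
  summand≈ n x y q j = sym (*-cong
    (*-congˡ (F≈f (n ∸ j) (x * q ^ j) (y * q ^ j) q))
    (F≈f (n ∸ j) (x * q ^ suc j) (y * q ^ suc j) q))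

  summand-0 : ∀ n x y q →
    summand n x y q 0 ≈ x * f n x y q * f n (x * q ^ 1) (y * q ^ 1) q
  summand-0 n x y q = *-congʳ (*-cong
    (solve 1 (λ x → x :* con 1 :* con 1 := x) ≈-refl x)
    (f-cong n q (*-identityʳ x) (*-identityʳ y)))

  -- The factor `x * q ^ 2` supplies q² and `(y * q ^ 2) ^ j` supplies q²ʲ, which together are the
  -- growth of the floor exponent from j to j+2; `y * y` raises the power of y.
  summand-2+ : ∀ n x y q j →
    y * y * summand n (x * q ^ 2) (y * q ^ 2) q j ≈ summand (suc (suc n)) x y q (suc (suc j))
  summand-2+ n x y q j = begin
    y * y * (x * q ^ 2 * (y * q ^ 2) ^ j * q ^ e * f₁ * f₂)
      ≈⟨ *-congˡ (*-cong (*-cong (*-congʳ (*-congˡ yq²ʲ)) (shift j)) (shift (suc j))) ⟩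
    y * y * (x * q ^ 2 * (y ^ j * (q ^ j * q ^ j)) * q ^ e * g₁ * g₂)
      ≈⟨ solve 8 (λ x y q yʲ q²ʲ qᵉ g₁ g₂ →
             y :* y :* (x :* (q :* (q :* con 1)) :* (yʲ :* q²ʲ) :* qᵉ :* g₁ :* g₂)
             := x :* (y :* (y :* yʲ)) :* (q :* (q :* q²ʲ) :* qᵉ) :* g₁ :* g₂)
           ≈-refl x y q (y ^ j) (q ^ j * q ^ j) (q ^ e) g₁ g₂ ⟩
    x * y ^ suc (suc j) * (q * (q * (q ^ j * q ^ j)) * q ^ e) * g₁ * g₂
      ≈⟨ *-congʳ (*-congʳ (*-congˡ (sym q^⌊[2+j]²/2⌋))) ⟩
    summand (suc (suc n)) x y q (suc (suc j)) ∎
    where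
    e = ⌊ j ℕ.^ 2 /2⌋
    f₁ = f (n ∸ j) (x * q ^ 2 * q ^ j) (y * q ^ 2 * q ^ j) q
    f₂ = f (n ∸ j) (x * q ^ 2 * q ^ suc j) (y * q ^ 2 * q ^ suc j) q
    g₁ = f (n ∸ j) (x * q ^ suc (suc j)) (y * q ^ suc (suc j)) q
    g₂ = f (n ∸ j) (x * q ^ suc (suc (suc j))) (y * q ^ suc (suc (suc j))) q
    yq²ʲ : (y * q ^ 2) ^ j ≈ y ^ j * (q ^ j * q ^ j)
    yq²ʲ = begin
      (y * q ^ 2) ^ j          ≈⟨ ^-congˡ j (*-congˡ (*-congˡ (*-identityʳ q))) ⟩
      (y * (q * q)) ^ j        ≈⟨ ^-distrib-* y (q * q) j ⟩
      y ^ j * (q * q) ^ j      ≈⟨ *-congˡ (^-distrib-* q q j) ⟩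
      y ^ j * (q ^ j * q ^ j)  ∎
    q^⌊[2+j]²/2⌋ : q ^ ⌊ suc (suc j) ℕ.^ 2 /2⌋ ≈ q * (q * (q ^ j * q ^ j)) * q ^ e
    q^⌊[2+j]²/2⌋ = begin
      q ^ ⌊ suc (suc j) ℕ.^ 2 /2⌋          ≈⟨ ^-congʳ q (⌊[2+j]²/2⌋ j) ⟩
      q ^ (suc (suc (j ℕ.+ j)) ℕ.+ e)      ≈⟨ ^-homo-* q (suc (suc (j ℕ.+ j))) e ⟩
      q * (q * q ^ (j ℕ.+ j)) * q ^ e      ≈⟨ *-congʳ (*-congˡ (*-congˡ (^-homo-* q j j))) ⟩
      q * (q * (q ^ j * q ^ j)) * q ^ e    ∎
    shift : ∀ i → f (n ∸ j) (x * q ^ 2 * q ^ i) (y * q ^ 2 * q ^ i) q ≈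
                  f (n ∸ j) (x * q ^ suc (suc i)) (y * q ^ suc (suc i)) q
    shift i = f-cong (n ∸ j) q (*q²qⁱ x) (*q²qⁱ y)
      where
      *q²qⁱ : ∀ z → z * q ^ 2 * q ^ i ≈ z * q ^ suc (suc i)
      *q²qⁱ z = trans (*-assoc z (q ^ 2) (q ^ i)) (*-congˡ (sym (^-homo-* q 2 i)))

  -- Induction in steps of two, with x and y universally quantified because the hypothesis is
  -- applied at `x * q ^ 2` and `y * q ^ 2`.
  f-product : ∀ n x y q →
    f n x y q * f (suc n) x y q ≈ ∑[ i ≤ n ] summand n x y q (toℕ i)
  f-product 0 x y q =
    solve 1 (λ x → con 1 :* x := x :* con 1 :* con 1 :* con 1 :* con 1 :+ con 0) ≈-refl x
  f-product 1 x y q = begin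
    x * (x * (x * q ^ 1) + y * 1#)
      ≈⟨ solve 3 (λ x y xq → x :* (x :* xq :+ y :* con 1) :=
           x :* x :* xq :+ (x :* (y :* con 1) :* con 1 :* con 1 :* con 1 :+ con 0))
           ≈-refl x y (x * q ^ 1) ⟩
    x * x * (x * q ^ 1) + (summand 1 x y q 1 + 0#)
      ≈⟨ +-congʳ (sym (summand-0 1 x y q)) ⟩
    summand 1 x y q 0 + (summand 1 x y q 1 + 0#) ∎
  f-product (suc (suc n)) x y q = begin
    f₀ * (x * g₁ + y * h₂)
      -- `f₀` stays folded in the first product, which becomes the summand j = 0, and is unfolded in
      -- the second to expose `h₁` and `k₂`.
      ≈⟨ distribˡ f₀ (x * g₁) (y * h₂) ⟩
    f₀ * (x * g₁) + (x * h₁ + y * k₂) * (y * h₂)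
      -- The summand j = 1 has q-exponent ⌊1/2⌋ = 0, so its powers of y and q compute to `y * 1#`
      -- and `1#`.
      ≈⟨ solve 7 (λ x y f₀ g₁ h₁ h₂ k₂ →
           f₀ :* (x :* g₁) :+ (x :* h₁ :+ y :* k₂) :* (y :* h₂) :=
           x :* f₀ :* g₁ :+
             (x :* (y :* con 1) :* con 1 :* h₁ :* h₂ :+ y :* y :* (k₂ :* h₂)))
           ≈-refl x y f₀ g₁ h₁ h₂ k₂ ⟩
    x * f₀ * g₁ + (summand (suc (suc n)) x y q 1 + y * y * (k₂ * h₂))
      ≈⟨ +-cong (sym (summand-0 (suc (suc n)) x y q)) (+-congˡ rest) ⟩
    ∑[ i ≤ suc (suc n) ] summand (suc (suc n)) x y q (toℕ i) ∎
    where
    f₀ = f (suc (suc n)) x y q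
    g₁ = f (suc (suc n)) (x * q ^ 1) (y * q ^ 1) q
    h₁ = f (suc n) (x * q ^ 1) (y * q ^ 1) q
    h₂ = f (suc n) (x * q ^ 2) (y * q ^ 2) q
    k₂ = f n (x * q ^ 2) (y * q ^ 2) q
    -- Peeling two terms off the sum up to n+2 leaves, by computation, a sum up to n with indices
    -- raised by two.
    rest : y * y * (k₂ * h₂) ≈ ∑[ i ≤ n ] summand (suc (suc n)) x y q (suc (suc (toℕ i)))
    rest = begin
      y * y * (k₂ * h₂)
        ≈⟨ *-congˡ (f-product n (x * q ^ 2) (y * q ^ 2) q) ⟩
      y * y * ∑[ i ≤ n ] summand n (x * q ^ 2) (y * q ^ 2) q (toℕ i)
        -- A sum over i ≤ n has n+1 terms, hence the length `suc n`.
        ≈⟨ *-distribˡ-sum {suc n} (y * y) (λ i → summand n (x * q ^ 2) (y * q ^ 2) q (toℕ i)) ⟩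
      ∑[ i ≤ n ] (y * y * summand n (x * q ^ 2) (y * q ^ 2) q (toℕ i))
        ≈⟨ sum-cong-≋ {suc n} (λ i → summand-2+ n x y q (toℕ i)) ⟩
      ∑[ i ≤ n ] summand (suc (suc n)) x y q (suc (suc (toℕ i))) ∎

theorem4p5 : ∀ {c ℓ} (R : CommutativeRing c ℓ) →
    let open CommutativeRing R
        open GeneratingFunction R
    in ∀ (n : ℕ) (x y q : Carrier) →
       F n x y q * F (suc n) x y q ≈
       ∑[ i ≤ n ] (let j = toℕ i in
         x * y ^ j * q ^ ⌊ j ℕ.^ 2 /2⌋
           * F (n ∸ j) (x * q ^ j) (y * q ^ j) q
           * F (n ∸ j) (x * q ^ suc j) (y * q ^ suc j) q)
theorem4p5 R n x y q = trans (*-cong (F≈f R n x y q) (F≈f R (suc n) x y q))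
  (trans (f-product R n x y q) (sum-cong-≋ {suc n} λ i → summand≈ R n x y q (toℕ i)))
  where
  open CommutativeRing R
  open Sum semiring using (sum-cong-≋)
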